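{- Let $k \ge 1$ be an integer. If $G$ is a $k$-SI graph with $n(G)$ vertices and maximum degree $\Delta(G)$, then $$\Delta(G) \le \left\lfloor \frac{n(G)+k}{2} \right\rfloor,$$ where the equality holds if and only if $G \cong K_{\frac{n(G)+k}{2}, \frac{n(G)-k}{2}}$.
   Context: For a positive integer $k$, a graph $G$ is a $k$-stepwise irregular graph ($k$-SI graph) if $|d_G(u) - d_G(v)| = k$ for every edge $uv \in E(G)$, where $d_G(x)$ denotes the degree of the vertex $x$ in $G$. The order (number of vertices) of $G$ is $n(G)$, and $\Delta(G)$ is the maximum degree of $G$. $K_{p,q}$ denotes the complete bipartite graph with parts of sizes $p$ and $q$.
   Formalization: The equality characterization is stated only for n(G)+k even, since for n(G)+k odd the named graph does not exist although equality with the floor can occur (k=1, n=8); both parts of the complete bipartite graph are required to be nonempty. -}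

module Defs where

open import Data.Empty using (⊥)
open import Data.Fin using (Fin; splitAt)
open import Data.List using (List; allFin; filter; length; map)
open import Data.List.Extrema.Nat using (max)
open import Data.Nat using (ℕ; _+_; ∣_-_∣; NonZero)
open import Data.Product using (_×_)
open import Data.Sum using (_⊎_; inj₁; inj₂)
open import Data.Unit using (⊤; tt)
open import Function.Bundles using (_↔_; _⇔_; module Inverse)
open import Level using (0ℓ)
open import Relation.Binary.Core using (Rel)
open import Relation.Binary.Definitions using (Decidable; Symmetric)
open import Relation.Binary.PropositionalEquality using (_≡_)
open import Relation.Nullary using (¬_; yes; no)

record Graph : Set₁ where
  field
    order   : ℕ
    Adj     : Rel (Fin order) 0ℓ
    adj?    : Decidable Adj
    symm    : Symmetric Adj
    irrefl  : ∀ {v} → ¬ Adj v v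

open Graph public using (order)

Vertex : Graph → Set
Vertex G = Fin (order G)

vertices : (G : Graph) → List (Vertex G)
vertices G = allFin (order G)

deg : (G : Graph) → Vertex G → ℕ
deg G v = length (filter (Graph.adj? G v) (vertices G))

-- The value on the graph with no vertices is 0.
Δ : Graph → ℕ
Δ G = max 0 (map (deg G) (vertices G))

StepwiseIrregular : ℕ → Graph → Set
StepwiseIrregular k G =
  ∀ {u v} → Graph.Adj G u v → ∣ deg G u - deg G v ∣ ≡ k

infix 4 _≅_

record _≅_ (G H : Graph) : Set where
  field
    bijection : Vertex G ↔ Vertex H
    adj-iff   : ∀ u v → Graph.Adj G u v ⇔
                Graph.Adj H (Inverse.to bijection u) (Inverse.to bijection v)

module _ {A B : Set} where

  Opposite : Rel (A ⊎ B) 0ℓ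
  Opposite (inj₁ _) (inj₂ _) = ⊤
  Opposite (inj₂ _) (inj₁ _) = ⊤
  Opposite (inj₁ _) (inj₁ _) = ⊥
  Opposite (inj₂ _) (inj₂ _) = ⊥

  opposite? : Decidable Opposite
  opposite? (inj₁ _) (inj₂ _) = yes tt
  opposite? (inj₂ _) (inj₁ _) = yes tt
  opposite? (inj₁ _) (inj₁ _) = no λ ()
  opposite? (inj₂ _) (inj₂ _) = no λ ()

  opposite-sym : Symmetric Opposite
  opposite-sym {inj₁ _} {inj₂ _} _ = tt
  opposite-sym {inj₂ _} {inj₁ _} _ = tt

  opposite-irrefl : ∀ {x} → ¬ Opposite x x
  opposite-irrefl {inj₁ _} ()
  opposite-irrefl {inj₂ _} ()

-- The first p elements of Fin (p + q) form one part, the last q the other.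
K : ℕ → ℕ → Graph
K p q = record
  { order  = p + q
  ; Adj    = λ u v → Opposite (splitAt p u) (splitAt p v)
  ; adj?   = λ u v → opposite? (splitAt p u) (splitAt p v)
  ; symm   = λ {u} {v} → opposite-sym {x = splitAt p u} {y = splitAt p v}
  ; irrefl = λ {v} → opposite-irrefl {x = splitAt p v}
  }

-- Both parts of a complete bipartite graph are nonempty.  Without this, the
-- edgeless graph on k vertices would be K k 0 = K ((n + k)/2) ((n - k)/2) with
-- n = k; it is vacuously k-stepwise irregular but has Δ = 0, not (n + k)/2.
-- It also makes a truncated size q = (n ∸ k) / 2 with n ≤ k give a false
-- proposition.
IsCompleteBipartite : Graph → ℕ → ℕ → Set
IsCompleteBipartite G p q = NonZero p × NonZero q × G ≅ K p q

{-# OPTIONS --safe #-}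
-- Let v have maximum degree Δ and let u be a neighbour of v, so d(u) = Δ − k.
-- A common neighbour of u and v would have the same degree as u, so N(u) and
-- N(v) are disjoint and 2Δ − k ≤ n.  If equality holds, then N(u) is the
-- complement of N(v) for every neighbour u of v; a vertex w outside N(v) is
-- thus adjacent to all of N(v), and to nothing else because d(w) ≤ Δ.
module Submission where

open import Data.Nat using (ℕ; zero; suc; _+_; _∸_; _*_; _≤_; _<_; z≤n; ∣_-_∣; >-nonZero)
open import Data.Nat.Divisibility using (_∣_)
open import Data.Nat.DivMod using (_/_; m*n/n≡m; m/n*n≡m; /-monoˡ-≤)
open import Data.Nat.Properties
open import Data.Product using (_×_; Σ; ∃; _,_; proj₁; proj₂)
open import Function.Bundles using (_⇔_; _↔_; Inverse; Equivalence; mk⇔)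
open import Relation.Binary.PropositionalEquality using (_≡_; refl; sym; trans; cong; subst; subst₂; setoid; module ≡-Reasoning)
open import Defs
open import Data.Fin using (Fin; zero; suc; splitAt; join; _↑ˡ_; _↑ʳ_)
open import Data.Fin.Permutation using (↔⇒≡)
open import Data.Fin.Properties using (+↔⊎; splitAt-join; splitAt-↑ˡ; splitAt-↑ʳ; ↑ˡ-injective; injective⇒≤)
open import Data.List using (_∷_; allFin; filter; length; map; tabulate)
open import Data.List.Extrema.Nat using (argmax-sel; xs≤max)
open import Data.List.Membership.Propositional using (_∈_)
open import Data.List.Membership.Propositional.Properties using (∈-map⁺; ∈-map⁻; ∈-filter⁺; ∈-filter⁻; ∈-allFin; ∈-length)
open import Data.List.Membership.Setoid.Properties using (index-injective)
import Data.List.Relation.Unary.All as All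
open import Data.List.Relation.Unary.Any using (here; index)
open import Data.List.Relation.Binary.Pointwise using (Pointwise-≡⇒≡)
import Data.List.Relation.Binary.Sublist.Setoid.Properties as Sublist
import Data.List.Relation.Binary.Sublist.Setoid as Sublist
open import Data.Sum using (_⊎_; inj₁; inj₂; [_,_]′)
open import Data.Sum.Algebra using (⊎-comm; ⊎-assoc)
open import Data.Sum.Function.Propositional using (_⊎-↔_)
open import Data.Unit using (tt)
open import Function using (_∘_; id)
open import Function.Properties.Inverse using (↔-refl; ↔-sym; ↔-trans)
open import Level using (0ℓ)
open import Relation.Nullary using (¬_; yes; no; contradiction)
open import Relation.Unary using (Pred; Decidable; ∁; _⊆_)
open import Relation.Unary.Properties using (∁?)

-- Counting in finite sets.

-- `deg G v` unfolds to `count (Graph.adj? G v)`, so facts on counts apply to degrees directly.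
count : ∀ {n} {P : Pred (Fin n) 0ℓ} → Decidable P → ℕ
count {n} P? = length (filter P? (allFin n))

count>0⇒∃ : ∀ {n} {P : Pred (Fin n) 0ℓ} (P? : Decidable P) → 0 < count P? → ∃ P
count>0⇒∃ {n} P? 0<c = go (filter P? (allFin n)) (proj₂ ∘ ∈-filter⁻ P? {xs = allFin n}) 0<c
  where
  go : ∀ xs → (∀ {x} → x ∈ xs → _) → 0 < length xs → ∃ _
  go (x ∷ _) all _ = x , all (here refl)

∃⇒count>0 : ∀ {n} {P : Pred (Fin n) 0ℓ} (P? : Decidable P) → ∀ {i} → P i → 0 < count P?
∃⇒count>0 P? {i} Pi = ∈-length (∈-filter⁺ P? (∈-allFin i) Pi)

-- The position of `f i` in the filtered list depends injectively on `i`.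
injection⇒≤count : ∀ {m n} {P : Pred (Fin n) 0ℓ} (P? : Decidable P) (f : Fin m → Fin n) →
                   (∀ {i j} → f i ≡ f j → i ≡ j) → (∀ i → P (f i)) → m ≤ count P?
injection⇒≤count P? f f-inj Pf =
  injective⇒≤ {f = index ∘ f∈} (λ {i} {j} eq → f-inj (index-injective (setoid _) (f∈ i) (f∈ j) eq))
  where
  f∈ = λ i → ∈-filter⁺ P? (∈-allFin (f i)) (Pf i)

module _ {n} {P Q : Pred (Fin n) 0ℓ} (P? : Decidable P) (Q? : Decidable Q) (P⊆Q : P ⊆ Q) where

  private
    sublist = Sublist.filter⁺ (setoid _) P? Q? (λ { refl → P⊆Q }) (Sublist.⊆-refl (setoid _) {x = allFin n})

  count-mono : count P? ≤ count Q?
  count-mono = Sublist.length-mono-≤ (setoid _) sublist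

  -- Filtering by `P` gives a sublist of filtering by `Q`, and a sublist that is not shorter is the
  -- whole list.
  ⊆∧count≥⇒⊇ : count Q? ≤ count P? → Q ⊆ P
  ⊆∧count≥⇒⊇ ≥ {x} Qx =
    proj₂ (∈-filter⁻ P? {xs = allFin n} (subst (x ∈_) (sym filters≡) (∈-filter⁺ Q? (∈-allFin x) Qx)))
    where
    filters≡ : filter P? (allFin n) ≡ filter Q? (allFin n)
    filters≡ = Pointwise-≡⇒≡ (Sublist.to-≋ (setoid _) (≤-antisym count-mono ≥) sublist)

-- Sorting a finite set by a decidable predicate.

-- Phrased by cases on the image, so that matching on `to e i` turns the proof at `i` into one of
-- `P i` or of its negation.
Sorts : ∀ {n a b} → Pred (Fin n) 0ℓ → Fin n ↔ (Fin a ⊎ Fin b) → Set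
Sorts P e = ∀ i → [ (λ _ → P i) , (λ _ → ¬ P i) ]′ (Inverse.to e i)

consˡ : ∀ {n a b} → Fin n ↔ (Fin a ⊎ Fin b) → Fin (suc n) ↔ (Fin (suc a) ⊎ Fin b)
consˡ {n} {a} {b} e =
  ↔-trans (+↔⊎ {1} {n})
    (↔-trans (↔-refl ⊎-↔ e)
      (↔-trans (↔-sym (⊎-assoc 0ℓ (Fin 1) (Fin a) (Fin b)))
        (↔-sym (+↔⊎ {1} {a}) ⊎-↔ ↔-refl)))

consʳ : ∀ {n a b} → Fin n ↔ (Fin a ⊎ Fin b) → Fin (suc n) ↔ (Fin a ⊎ Fin (suc b))
consʳ e = ↔-trans (consˡ (↔-trans e (⊎-comm _ _))) (⊎-comm _ _)

module _ {n a b} {P : Pred (Fin (suc n)) 0ℓ} (e : Fin n ↔ (Fin a ⊎ Fin b)) (sorted : Sorts (P ∘ suc) e) where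

  consˡ-sorts : P zero → Sorts P (consˡ e)
  consˡ-sorts P₀ zero = P₀
  consˡ-sorts P₀ (suc i) with Inverse.to e i | sorted i
  ... | inj₁ _ | Pᵢ  = Pᵢ
  ... | inj₂ _ | ¬Pᵢ = ¬Pᵢ

  consʳ-sorts : ¬ P zero → Sorts P (consʳ e)
  consʳ-sorts ¬P₀ zero = ¬P₀
  consʳ-sorts ¬P₀ (suc i) with Inverse.to e i | sorted i
  ... | inj₁ _ | Pᵢ  = Pᵢ
  ... | inj₂ _ | ¬Pᵢ = ¬Pᵢ

-- Stated for an arbitrary `f`, so that the induction on `n` can pass to `f ∘ suc`; `allFin n` is
-- the case `f = id`.
sort-tabulate : ∀ {A : Set} {P : Pred A 0ℓ} (P? : Decidable P) {n} (f : Fin n → A) →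
  Σ (Fin n ↔ (Fin (length (filter P? (tabulate f))) ⊎ Fin (length (filter (∁? P?) (tabulate f))))) (Sorts (P ∘ f))
sort-tabulate P? {zero} f = +↔⊎ {0} {0} , λ ()
sort-tabulate P? {suc n} f with P? (f zero) | sort-tabulate P? (f ∘ suc)
... | yes P₀ | e , sorted = consˡ e , consˡ-sorts e sorted P₀
... | no ¬P₀ | e , sorted = consʳ e , consʳ-sorts e sorted ¬P₀

sort : ∀ {n} {P : Pred (Fin n) 0ℓ} (P? : Decidable P) →
       Σ (Fin n ↔ (Fin (count P?) ⊎ Fin (count (∁? P?)))) (Sorts P)
sort P? = sort-tabulate P? id

count+count-∁ : ∀ {n} {P : Pred (Fin n) 0ℓ} (P? : Decidable P) → count P? + count (∁? P?) ≡ n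
count+count-∁ P? = sym (↔⇒≡ (↔-trans (proj₁ (sort P?)) (↔-sym +↔⊎)))

-- Maximum degree and arithmetic.

deg≤Δ : ∀ G v → deg G v ≤ Δ G
deg≤Δ G v = All.lookup (xs≤max 0 _) (∈-map⁺ (deg G) (∈-allFin v))

-- A maximum is either an entry of the list or the default 0, and positivity rules out the default.
0<Δ⇒∃deg≡Δ : ∀ G → 0 < Δ G → ∃ λ v → deg G v ≡ Δ G
0<Δ⇒∃deg≡Δ G 0<Δ with argmax-sel id 0 (map (deg G) (vertices G))
... | inj₁ Δ≡0 = contradiction Δ≡0 (>⇒≢ 0<Δ)
... | inj₂ Δ∈ with ∈-map⁻ (deg G) Δ∈
...   | v , _ , Δ≡ = v , sym Δ≡

∣m-n∣≡k∧m≤n⇒m+k≡n : ∀ {m n k} → ∣ m - n ∣ ≡ k → m ≤ n → m + k ≡ n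
∣m-n∣≡k∧m≤n⇒m+k≡n {m} {n} {k} eq m≤n = begin
  m + k         ≡⟨ cong (m +_) (trans (sym eq) (m≤n⇒∣m-n∣≡n∸m m≤n)) ⟩
  m + (n ∸ m)   ≡⟨ m+[n∸m]≡n m≤n ⟩
  n             ∎
  where open ≡-Reasoning

m*2≡m+m : ∀ m → m * 2 ≡ m + m
m*2≡m+m m = trans (*-comm m 2) (cong (m +_) (+-identityʳ m))

m≤n/2 : ∀ {m n} → m * 2 ≤ n → m ≤ n / 2
m≤n/2 {m} {n} 2m≤n = subst (_≤ n / 2) (m*n/n≡m m 2) (/-monoˡ-≤ 2 2m≤n)

-- Complete bipartite graphs.

-- A vertex of the second part is adjacent to all `p` vertices of the first.
completeBipartite⇒p≤Δ : ∀ {G p q} → IsCompleteBipartite G p q → p ≤ Δ G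
-- `NonZero 0` is empty, so the second part has a first vertex, which serves as `v`.
completeBipartite⇒p≤Δ {G} {p} {suc q} (_ , _ , G≅K) =
  ≤-trans (injection⇒≤count (Graph.adj? G v) left left-injective v~left) (deg≤Δ G v)
  where
  open _≅_ G≅K
  open Inverse bijection using (to; from; strictlyInverseˡ)
  v = from (p ↑ʳ zero)
  left : Fin p → Vertex G
  left i = from (i ↑ˡ suc q)
  left-injective : ∀ {i j} → left i ≡ left j → i ≡ j
  left-injective {i} {j} eq = ↑ˡ-injective (suc q) i j
    (trans (sym (strictlyInverseˡ _)) (trans (cong to eq) (strictlyInverseˡ _)))
  v~left : ∀ i → Graph.Adj G v (left i)
  v~left i = Equivalence.from (adj-iff v (left i)) opposite
    where
    opposite : Opposite (splitAt p (to v)) (splitAt p (to (left i)))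
    opposite rewrite strictlyInverseˡ (p ↑ʳ zero {q}) | strictlyInverseˡ (i ↑ˡ suc q)
                   | splitAt-↑ʳ p (suc q) zero | splitAt-↑ˡ p i (suc q) = tt

module _ (G : Graph) where
  open Graph G using (Adj; adj?; symm; irrefl)

  module _ {P : Pred (Vertex G) 0ℓ} (P? : Decidable P)
           (P-independent : ∀ {x y} → P x → P y → ¬ Adj x y)
           (∁P-independent : ∀ {x y} → ¬ P x → ¬ P y → ¬ Adj x y)
           (P~∁P : ∀ {x y} → P x → ¬ P y → Adj x y) where

    -- Sorting the vertices by `P` is the isomorphism: the three hypotheses settle adjacency within
    -- and between the two sides.
    ≅K : G ≅ K (count P?) (count (∁? P?))
    ≅K = record { bijection = ↔-trans e (↔-sym +↔⊎) ; adj-iff = adj-iff }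
      where
      p = count P?
      q = count (∁? P?)
      e = proj₁ (sort P?)
      open Inverse e using (to)
      adj⇔opposite : ∀ x y → Adj x y ⇔ Opposite (to x) (to y)
      adj⇔opposite x y with to x | proj₂ (sort P?) x | to y | proj₂ (sort P?) y
      ... | inj₁ _ | Px  | inj₁ _ | Py  = mk⇔ (P-independent Px Py) λ ()
      ... | inj₁ _ | Px  | inj₂ _ | ¬Py = mk⇔ _ λ _ → P~∁P Px ¬Py
      ... | inj₂ _ | ¬Px | inj₁ _ | Py  = mk⇔ _ λ _ → symm (P~∁P Py ¬Px)
      ... | inj₂ _ | ¬Px | inj₂ _ | ¬Py = mk⇔ (∁P-independent ¬Px ¬Py) λ ()
      -- `K` reads off the part of a vertex by `splitAt`, which undoes the `join` at the end of the
      -- bijection.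
      adj-iff : ∀ x y → Adj x y ⇔ Opposite (splitAt p (join p q (to x))) (splitAt p (join p q (to y)))
      adj-iff x y rewrite splitAt-join p q (to x) | splitAt-join p q (to y) = adj⇔opposite x y

  -- Neighbourhoods around a vertex of maximum degree.

  module _ {k} (1≤k : 1 ≤ k) (G-SI : StepwiseIrregular k G) {v} (deg-v≡Δ : deg G v ≡ Δ G) where

    private
      d = deg G v
      c = count (∁? (adj? v))

      d+c≡n : d + c ≡ order G
      d+c≡n = count+count-∁ (adj? v)

      deg≤d : ∀ w → deg G w ≤ d
      deg≤d w = subst (deg G w ≤_) (sym deg-v≡Δ) (deg≤Δ G w)

    -- Maximality of `d` fixes the sign inside the absolute value.
    neighbour-deg : ∀ {u} → Adj v u → deg G u + k ≡ d
    neighbour-deg {u} v~u = ∣m-n∣≡k∧m≤n⇒m+k≡n (G-SI (symm v~u)) (deg≤d u)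

    neighbourhoods-disjoint : ∀ {u} → Adj v u → Adj u ⊆ ∁ (Adj v)
    neighbourhoods-disjoint {u} v~u {w} u~w v~w =
      -- Equal degrees at the ends of the edge `u~w` would force `k` to be 0.
      >⇒≢ 1≤k (trans (sym (G-SI u~w)) (trans (cong (∣_- deg G w ∣) deg-u≡deg-w) (∣n-n∣≡0 (deg G w))))
      where
      deg-u≡deg-w : deg G u ≡ deg G w
      deg-u≡deg-w = +-cancelʳ-≡ k _ _ (trans (neighbour-deg v~u) (sym (neighbour-deg v~w)))

    -- All neighbours of `u` are among the `c` non-neighbours of `v`, and `d + c` counts every
    -- vertex.
    d*2≤n+k : ∀ {u} → Adj v u → d * 2 ≤ order G + k
    d*2≤n+k {u} v~u = begin
      d * 2               ≡⟨ m*2≡m+m d ⟩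
      d + d               ≡⟨ cong (d +_) (neighbour-deg v~u) ⟨
      d + (deg G u + k)   ≤⟨ +-monoʳ-≤ d (+-monoˡ-≤ k (count-mono (adj? u) (∁? (adj? v)) (neighbourhoods-disjoint v~u))) ⟩
      d + (c + k)         ≡⟨ +-assoc d c k ⟨
      d + c + k           ≡⟨ cong (_+ k) d+c≡n ⟩
      order G + k         ∎
      where open ≤-Reasoning

    module _ (0<d : 0 < d) (n+k≡d*2 : order G + k ≡ d * 2) where

      private
        -- Equality in the bound makes `c` equal to the degree of each neighbour of `v`.
        c+k≡d : c + k ≡ d
        c+k≡d = +-cancelˡ-≡ d _ _ (begin
          d + (c + k)   ≡⟨ +-assoc d c k ⟨
          d + c + k     ≡⟨ cong (_+ k) d+c≡n ⟩
          order G + k   ≡⟨ n+k≡d*2 ⟩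
          d * 2         ≡⟨ m*2≡m+m d ⟩
          d + d         ∎)
          where open ≡-Reasoning

        n∸k≡c*2 : order G ∸ k ≡ c * 2
        n∸k≡c*2 = begin
          order G ∸ k       ≡⟨ cong (_∸ k) d+c≡n ⟨
          d + c ∸ k         ≡⟨ cong (λ m → m + c ∸ k) c+k≡d ⟨
          c + k + c ∸ k     ≡⟨ cong (_∸ k) (+-comm (c + k) c) ⟩
          c + (c + k) ∸ k   ≡⟨ cong (_∸ k) (+-assoc c c k) ⟨
          c + c + k ∸ k     ≡⟨ m+n∸n≡m (c + c) k ⟩
          c + c             ≡⟨ m*2≡m+m c ⟨
          c * 2             ∎
          where open ≡-Reasoning

        -- The neighbourhood of `u` lies in the complement of that of `v`, and both have `c`
        -- elements.
        v~∁v : ∀ {u w} → Adj v u → ¬ Adj v w → Adj u w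
        v~∁v {u} v~u = ⊆∧count≥⇒⊇ (adj? u) (∁? (adj? v)) (neighbourhoods-disjoint v~u)
          (≤-reflexive (+-cancelʳ-≡ k _ _ (trans c+k≡d (sym (neighbour-deg v~u)))))

        -- The neighbourhood of `w` contains that of `v` and has at most `d` elements, so the two
        -- coincide.
        ∁v-independent : ∀ {w x} → ¬ Adj v w → ¬ Adj v x → ¬ Adj w x
        ∁v-independent {w} ¬v~w ¬v~x w~x = ¬v~x
          (⊆∧count≥⇒⊇ (adj? v) (adj? w) (λ v~u → symm (v~∁v v~u ¬v~w)) (deg≤d w) w~x)

      extremal⇒completeBipartite : IsCompleteBipartite G ((order G + k) / 2) ((order G ∸ k) / 2)
      extremal⇒completeBipartite = subst₂ (IsCompleteBipartite G)
        (sym (trans (cong (_/ 2) n+k≡d*2) (m*n/n≡m d 2)))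
        (sym (trans (cong (_/ 2) n∸k≡c*2) (m*n/n≡m c 2)))
        ( >-nonZero 0<d
        -- The second part contains `v` itself, since `v` is not its own neighbour.
        , >-nonZero (∃⇒count>0 (∁? (adj? v)) irrefl)
        , ≅K (adj? v) (λ v~x v~y x~y → neighbourhoods-disjoint v~x x~y v~y) ∁v-independent v~∁v)

-- The bound and its equality case.

Δ≤[n+k]/2 : ∀ {k} → 1 ≤ k → ∀ G → StepwiseIrregular k G → Δ G ≤ (order G + k) / 2
Δ≤[n+k]/2 {k} 1≤k G G-SI with m≤n⇒m<n∨m≡n (z≤n {Δ G})
-- With maximum degree 0 there is no neighbour `u` to argue with, but the bound is trivial.
... | inj₂ 0≡Δ = subst (_≤ (order G + k) / 2) 0≡Δ z≤n
... | inj₁ 0<Δ with 0<Δ⇒∃deg≡Δ G 0<Δ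
...   | v , deg-v≡Δ with count>0⇒∃ (Graph.adj? G v) (subst (0 <_) (sym deg-v≡Δ) 0<Δ)
...     | u , v~u = subst (_≤ (order G + k) / 2) deg-v≡Δ (m≤n/2 (d*2≤n+k G 1≤k G-SI deg-v≡Δ v~u))

-- Divisibility makes the halving exact; the floor alone would also allow `n + k = 2Δ + 1`.
Δ≡[n+k]/2⇒completeBipartite : ∀ {k} → 1 ≤ k → ∀ G → StepwiseIrregular k G → 2 ∣ order G + k →
  Δ G ≡ (order G + k) / 2 → IsCompleteBipartite G ((order G + k) / 2) ((order G ∸ k) / 2)
Δ≡[n+k]/2⇒completeBipartite {k} 1≤k G G-SI 2∣n+k Δ≡ =
  extremal⇒completeBipartite G 1≤k G-SI deg-v≡Δ (subst (0 <_) (sym deg-v≡Δ) 0<Δ)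
    (trans n+k≡Δ*2 (cong (_* 2) (sym deg-v≡Δ)))
  where
  n+k≡Δ*2 : order G + k ≡ Δ G * 2
  n+k≡Δ*2 = trans (sym (m/n*n≡m 2∣n+k)) (cong (_* 2) (sym Δ≡))
  0<Δ : 0 < Δ G
  -- Here `2Δ = n + k ≥ k ≥ 1`.
  0<Δ = *-cancelʳ-< 2 0 (Δ G) (subst (0 <_) n+k≡Δ*2 (≤-trans 1≤k (m≤n+m k (order G))))
  deg-v≡Δ = proj₂ (0<Δ⇒∃deg≡Δ G 0<Δ)

theorem4p2 : (k : ℕ) → 1 ≤ k → (G : Graph) → StepwiseIrregular k G →
    (Δ G ≤ (order G + k) / 2)
    × (2 ∣ order G + k →
    (Δ G ≡ (order G + k) / 2
    ⇔ IsCompleteBipartite G ((order G + k) / 2) ((order G ∸ k) / 2)))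
theorem4p2 k 1≤k G G-SI = bound , λ 2∣n+k →
  -- For the converse, the first part has `(n + k) / 2` vertices, which bounds `Δ` from below.
  mk⇔ (Δ≡[n+k]/2⇒completeBipartite 1≤k G G-SI 2∣n+k) (≤-antisym bound ∘ completeBipartite⇒p≤Δ)
  where
  bound = Δ≤[n+k]/2 1≤k G G-SI
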